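{- Let $k\in\{1,\dots,N\}$ satisfy $\phi^{k-1}-\phi^k>\phi^k-\phi^{k+1}$. Let $F\in\tilde{\mathcal F}^k$, let $\mathcal U$ be an unlabeled atom and $\mathcal M$ a labeled atom of $\mathfrak A_k$. If $F$ contains an arc leaving $\mathcal U$ and ending in $\mathcal M$, then this arc is the only arc of $F$ leaving $\mathcal U$.
   Context: Let $V$ be a finite digraph with vertex set $\mathcal N$, $|\mathcal N|=N$, whose arcs $(i,j)$ carry real weights $v_{ij}$. An (entering) forest is a digraph in which at most one arc leaves each vertex and which contains no directed cycle; its weakly connected components are (entering) trees, the root of a tree being its unique vertex with no outgoing arc. A spanning forest is a subgraph of $V$ which is a forest with vertex set $\mathcal N$. For a subgraph $G$ of $V$ let $\Upsilon^G=\sum_{(i,j)\in\mathcal AG}v_{ij}$. Let $\mathcal F^k$ be the set of spanning forests with exactly $k$ trees, $\phi^k=\min_{F\in\mathcal F^k}\Upsilon^F$, with $\phi^k=\infty$ if $\mathcal F^k=\emptyset$ (so $\phi^0=\phi^{N+1}=\infty$; conventions $\infty-a=\infty$, $a-\infty=-\infty$ for finite $a$), and $\tilde{\mathcal F}^k=\{F\in\mathcal F^k:\Upsilon^F=\phi^k\}$. Standing assumption: $V$ has at least one spanning tree. $\mathfrak A_k$ is the algebra of subsets of $\mathcal N$ generated (by complements and intersections) by the vertex sets of all trees of all forests in $\tilde{\mathcal F}^k$; an atom is a nonempty $\mathcal A\in\mathfrak A_k$ with $\mathcal A\cap\mathcal B\in\{\emptyset,\mathcal A\}$ for all $\mathcal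 B\in\mathfrak A_k$. An atom is labeled if it contains the root of some tree of some forest in $\tilde{\mathcal F}^k$, and unlabeled otherwise. An arc $(i,j)$ leaves a set $\mathcal S$ if $i\in\mathcal S$, $j\notin\mathcal S$. -}

module Defs where

open import Data.Nat using (ℕ; zero; suc; _∸_) renaming (_+_ to _+ℕ_)
open import Data.Fin using (Fin)
open import Data.Fin.Subset using (Subset; _∈_; _∉_; ∁; _∩_; ⊥)
open import Data.List using (List; foldr; allFin)
open import Data.Maybe using (Maybe; just; nothing)
open import Data.Product using (Σ; ∃; _×_; _,_)
open import Data.Sum using (_⊎_)
open import Data.Empty renaming (⊥ to Empty)
open import Relation.Nullary using (¬_)
open import Relation.Binary using (Rel; IsDecTotalOrder)
open import Relation.Binary.PropositionalEquality using (_≡_; _≢_)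

-- Weights.  Agda has no real numbers; we take the weights in an
-- arbitrary (decidably) totally ordered abelian group, of which ℝ is an
-- instance.  (Only +, -, and ≤ of ℝ are used by the statement.)

record OrdAbGroup : Set₁ where
  infixl 6 _+_
  infix 4 _≤_
  field
    Carrier  : Set
    _+_      : Carrier → Carrier → Carrier
    0#       : Carrier
    -_       : Carrier → Carrier
    _≤_      : Rel Carrier _
    +-assoc     : ∀ a b c → (a + b) + c ≡ a + (b + c)
    +-comm      : ∀ a b → a + b ≡ b + a
    +-identityˡ : ∀ a → 0# + a ≡ a
    -‿inverseˡ  : ∀ a → (- a) + a ≡ 0#
    ≤-isDecTotalOrder : IsDecTotalOrder _≡_ _≤_
    +-monoˡ-≤   : ∀ {a b} c → a ≤ b → a + c ≤ b + c

  _-_ : Carrier → Carrier → Carrier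
  a - b = a + (- b)

  _<_ : Rel Carrier _
  a < b = a ≤ b × a ≢ b

record Digraph (G : OrdAbGroup) (N : ℕ) : Set₁ where
  open OrdAbGroup G
  field
    Arc : Fin N → Fin N → Set
    v   : Fin N → Fin N → Carrier        -- weight v_ij (used on arcs)

module Graph (G : OrdAbGroup) {N : ℕ} (D : Digraph G N) where
  open OrdAbGroup G
  open Digraph D

  data Ext : Set where
    fin : Carrier → Ext
    ∞   : Ext

  data Ext± : Set where
    -∞   : Ext±
    fin± : Carrier → Ext±
    +∞   : Ext±

  -- conventions: ∞ - a = ∞, a - ∞ = -∞ for finite a.
  -- (∞ - ∞ never occurs in the statement; it is set to ∞ arbitrarily.)
  _⊖_ : Ext → Ext → Ext±
  fin a ⊖ fin b = fin± (a - b)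
  fin a ⊖ ∞     = -∞
  ∞     ⊖ fin b = +∞
  ∞     ⊖ ∞     = +∞

  data _<±_ : Ext± → Ext± → Set where
    -∞<fin : ∀ {a} → -∞ <± fin± a
    -∞<+∞  : -∞ <± +∞
    fin<fin : ∀ {a b} → a < b → fin± a <± fin± b
    fin<+∞ : ∀ {a} → fin± a <± +∞

  -- A subgraph of V with vertex set 𝒩 in which at most one arc leaves
  -- each vertex: given by the (optional) head of the arc leaving i.
  record OutSubgraph : Set where
    field
      out    : Fin N → Maybe (Fin N)
      out⊆V  : ∀ i j → out i ≡ just j → Arc i j
  open OutSubgraph public

  data Walk (H : OutSubgraph) : Fin N → Fin N → Set where
    step : ∀ {i j} → out H i ≡ just j → Walk H i j
    _∷_  : ∀ {i j k} → out H i ≡ just j → Walk H j k → Walk H i k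

  record SpanningForest : Set where
    field
      graph   : OutSubgraph
      acyclic : ∀ i → ¬ Walk graph i i
  open SpanningForest public

  data WConn (F : SpanningForest) : Fin N → Fin N → Set where
    wrefl  : ∀ {i} → WConn F i i
    wfwd   : ∀ {i j k} → out (graph F) i ≡ just j → WConn F j k → WConn F i k
    wbwd   : ∀ {i j k} → out (graph F) j ≡ just i → WConn F j k → WConn F i k

  IsRoot : SpanningForest → Fin N → Set
  IsRoot F r = out (graph F) r ≡ nothing

  InTree : SpanningForest → Fin N → Fin N → Set
  InTree F r i = WConn F i r

  -- number of trees = number of roots
  numTrees : SpanningForest → ℕ
  numTrees F = foldr (λ i n → rootInd (out (graph F) i) +ℕ n) 0 (allFin N)
    where
    rootInd : Maybe (Fin N) → ℕ
    rootInd nothing  = 1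
    rootInd (just _) = 0

  weight : SpanningForest → Carrier
  weight F = foldr (λ i s → arcW i (out (graph F) i) + s) 0# (allFin N)
    where
    arcW : Fin N → Maybe (Fin N) → Carrier
    arcW i nothing  = 0#
    arcW i (just j) = v i j

  InF : ℕ → SpanningForest → Set
  InF k F = numTrees F ≡ k

  Phi : ℕ → Ext → Set
  Phi k ∞       = ¬ (Σ SpanningForest λ F → InF k F)
  Phi k (fin x) = (Σ SpanningForest λ F → InF k F × weight F ≡ x)
                × (∀ F → InF k F → x ≤ weight F)

  Optimal : ℕ → SpanningForest → Set
  Optimal k F = InF k F × (∀ F′ → InF k F′ → weight F ≤ weight F′)

  data InAlg (k : ℕ) : Subset N → Set where
    gen   : ∀ {S} (F : SpanningForest) (r : Fin N) → Optimal k F → IsRoot F r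
          → (∀ i → (i ∈ S → InTree F r i) × (InTree F r i → i ∈ S))
          → InAlg k S
    compl : ∀ {S} → InAlg k S → InAlg k (∁ S)
    inter : ∀ {S T} → InAlg k S → InAlg k T → InAlg k (S ∩ T)

  IsAtom : ℕ → Subset N → Set
  IsAtom k A = (∃ λ i → i ∈ A) × InAlg k A
             × (∀ B → InAlg k B → (A ∩ B ≡ ⊥) ⊎ (A ∩ B ≡ A))

  Labeled : ℕ → Subset N → Set
  Labeled k A = Σ SpanningForest λ F → Optimal k F × ∃ λ r → IsRoot F r × r ∈ A

  HasSpanningTree : Set
  HasSpanningTree = Σ SpanningForest λ F → InF 1 F

{-# OPTIONS --safe #-}
module Submission where

-- Write x ~ y if x and y lie in the same tree of every optimal forest; the atoms
-- are the classes of ~.  If two forests with k trees exchange their arcs on a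
-- vertex set and both results are forests, then strict convexity at k makes the
-- results optimal whenever the originals are.  Exchanging on a single tree shows
-- that a tree of one optimal forest contains exactly one root of any other, and
-- hence that no optimal forest leaves a labeled atom.
--
-- Let F be optimal with an arc i → j, j in a labeled atom, and let H be optimal
-- separating i from j.  Then every i′ ~ i lies below i in F: otherwise exchange F
-- and H on the set of vertices below i.  In both resulting forests i stays in the
-- tree of j, and what is no longer in that tree can be grafted onto F, bringing F
-- closer to H.  When no such improvement exists, the last disagreement of F and H
-- on the H-path of i is contradictory.
--
-- Finally, given a second exit i′ → j′ of F with H separating i′ from j′, take F
-- on the H-tree of i and H elsewhere: this forest is optimal and contains i → j,
-- but its path from i′ leaves the H-tree of i for good, so i′ is not below i.

open import Defs
open import Data.Nat using (ℕ; zero; suc; _∸_; _≤_; _<_; _+_; s≤s; s<s; z≤n)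
import Data.Nat.Properties as ℕ
open import Data.Fin using (Fin; toℕ)
import Data.Fin as Fin
import Data.Fin.Properties as Fin
open import Data.Fin.Subset using (Subset; _∈_; _∉_)
open import Data.Fin.Subset.Properties
  using (x∈p∩q⁺; x∈p∩q⁻; x∈∁p⇒x∉p; x∉p⇒x∈∁p; ∉⊥)
open import Data.Bool using (if_then_else_)
open import Data.List
  using (List; []; _∷_; [_]; foldr; allFin; filter; length; map; cartesianProductWith)
import Data.List.Membership.Propositional as List
open import Data.List.Membership.Propositional.Properties
  using (∈-∃++; ∈-filter⁺; ∈-filter⁻; ∈-allFin; ∈-map⁺; ∈-cartesianProductWith⁺)
open import Data.List.Properties using (length-map; filter-notAll)
open import Data.List.Relation.Binary.Permutation.Propositional.Properties
  using (shift; ↭-length; ∈-resp-↭)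
open import Data.List.Relation.Unary.All.Properties using (¬Any⇒All¬; All¬⇒¬Any)
open import Data.List.Relation.Unary.Any using (here; there) renaming (map to Any-map)
open import Data.List.Relation.Unary.Unique.Propositional using (Unique; []; _∷_)
import Data.List.Relation.Unary.Unique.Propositional.Properties as Unique
open import Data.Maybe using (Maybe; just; nothing)
import Data.Maybe.Properties as Maybe
open import Data.Product using (Σ; ∃; _×_; _,_; proj₁; proj₂)
open import Data.Sum using (_⊎_; inj₁; inj₂; swap) renaming ([_,_]′ to either)
open import Data.Vec using (tabulate)
open import Data.Vec.Properties using (lookup∘tabulate; lookup⇒[]=; []=⇒lookup)
open import Data.Empty using (⊥; ⊥-elim)
open import Function using (_∘_; flip; id)
open import Relation.Nullary using (¬_; Dec; yes; no; does; contradiction)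
open import Relation.Nullary.Decidable using (¬?; _×-dec_; dec-true; decidable-stable)
open import Relation.Binary using (IsDecTotalOrder; tri<; tri≈; tri>)
open import Relation.Binary.PropositionalEquality
  using (_≡_; _≢_; refl; sym; trans; cong; cong₂; subst; subst₂; module ≡-Reasoning)

-- Counting in lists without repetition.

unique-⊆⇒length≤ : {A : Set} {xs ys : List A} → Unique xs →
  (∀ {x} → x List.∈ xs → x List.∈ ys) → length xs ≤ length ys
unique-⊆⇒length≤ []         xs⊆ys = z≤n
unique-⊆⇒length≤ (x∉ ∷ xs!) xs⊆ys with ∈-∃++ (xs⊆ys (here refl))
... | as , bs , refl =
  ℕ.≤-trans (s≤s (unique-⊆⇒length≤ xs! below))
            (ℕ.≤-reflexive (sym (↭-length (shift _ as bs))))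
  where
  below : ∀ {y} → y List.∈ _ → y List.∈ _
  below y∈ with ∈-resp-↭ (shift _ as bs) (xs⊆ys (there y∈))
  ... | here refl = contradiction y∈ (All¬⇒¬Any x∉)
  ... | there y∈′ = y∈′

-- Graphs with at most one arc out of each vertex.

module _ {N : ℕ} where

  Out : Set
  Out = Fin N → Maybe (Fin N)

  private variable
    o p : Out
    x y r : Fin N

  infix 4 _≟ᴹ_
  _≟ᴹ_ : (m n : Maybe (Fin N)) → Dec (m ≡ n)
  _≟ᴹ_ = Maybe.≡-dec Fin._≟_

  data Reach (o : Out) : Fin N → Fin N → Set where
    stop : o r ≡ nothing → Reach o r r
    go   : o x ≡ just y → Reach o y r → Reach o x r

  -- The target comes first, so that `Leads o i` is the set of vertices whose path meets `i`.
  data Leads (o : Out) (i : Fin N) : Fin N → Set where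
    arrived : Leads o i i
    via     : o x ≡ just y → Leads o i y → Leads o i x

  just-functional : {m : Maybe (Fin N)} → m ≡ just x → m ≡ just y → x ≡ y
  just-functional e e′ = Maybe.just-injective (trans (sym e) e′)

  just≢nothing : {m : Maybe (Fin N)} → m ≡ just x → m ≢ nothing
  just≢nothing e e′ with trans (sym e) e′
  ... | ()

  Reach-functional : ∀ {r′} → Reach o x r → Reach o x r′ → r ≡ r′
  Reach-functional (stop e) (stop e′) = refl
  Reach-functional (stop e) (go e′ q) = contradiction e (just≢nothing e′)
  Reach-functional (go e q) (stop e′) = contradiction e′ (just≢nothing e)
  Reach-functional (go e q) (go e′ q′) with just-functional e e′
  ... | refl = Reach-functional q q′

  Reach-end : Reach o x r → o r ≡ nothing
  Reach-end (stop e) = e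
  Reach-end (go _ q) = Reach-end q

  leads? : ∀ i → Reach o x r → Dec (Leads o i x)
  leads? {x = x} i q with x Fin.≟ i
  ... | yes refl = yes arrived
  leads? i (stop e) | no x≢i = no λ where
    arrived    → x≢i refl
    (via e′ _) → just≢nothing e′ e
  leads? i (go e q) | no x≢i with leads? i q
  ... | yes l = yes (via e l)
  ... | no ¬l = no λ where
    arrived    → x≢i refl
    (via e′ l) → ¬l (subst (Leads _ i) (just-functional e′ e) l)

  follow : (C : Fin N → Set) → (∀ {x y} → C x → p x ≡ just y → C y) →
           (∀ {x} → C x → o x ≡ p x) → C x → Reach p x r → Reach o x r
  follow C closed agree c (stop e) = stop (trans (agree c) e)
  follow C closed agree c (go e q) =
    go (trans (agree c) e) (follow C closed agree (closed c e) q)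

  Trace : Out → Fin N → ℕ → Set
  Trace o x n = Σ (ℕ → Fin N) λ g → g 0 ≡ x × ∀ {m} → m < n → o (g m) ≡ just (g (suc m))

  reach-or-trace : ∀ o n x → ∃ (Reach o x) ⊎ Trace o x n
  reach-or-trace o zero x = inj₂ ((λ _ → x) , refl , λ ())
  reach-or-trace o (suc n) x with o x in e
  ... | nothing = inj₁ (x , stop e)
  ... | just y with reach-or-trace o n y
  ... | inj₁ (r , q) = inj₁ (r , go e q)
  ... | inj₂ (g , g0≡y , arcs) = inj₂ (g′ , refl , arcs′)
    where
    g′ : ℕ → Fin N
    g′ zero    = x
    g′ (suc m) = g m
    arcs′ : ∀ {m} → m < suc n → o (g′ m) ≡ just (g′ (suc m))
    arcs′ {zero}  _         = trans e (cong just (sym g0≡y))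
    arcs′ {suc m} (s<s m<n) = arcs m<n

  root? : (o : Out) → ∀ x → Dec (o x ≡ nothing)
  root? o x = o x ≟ᴹ nothing

  roots : Out → List (Fin N)
  roots o = filter (root? o) (allFin N)

  ∈-roots⁺ : o x ≡ nothing → x List.∈ roots o
  ∈-roots⁺ {o} = ∈-filter⁺ (root? o) (∈-allFin _)

  ∈-roots⁻ : x List.∈ roots o → o x ≡ nothing
  ∈-roots⁻ {o = o} = proj₂ ∘ ∈-filter⁻ (root? o) {xs = allFin N}

  roots-unique : ∀ o → Unique (roots o)
  roots-unique o = Unique.filter⁺ (root? o) (Unique.allFin⁺ N)

  differ? : (o p : Out) → ∀ x → Dec (o x ≢ p x)
  differ? o p x = ¬? (o x ≟ᴹ p x)

  differences : Out → Out → List (Fin N)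
  differences o p = filter (differ? o p) (allFin N)

  -- `b` followed by the differences of `o₁` and `p` is a list without repetition inside the
  -- differences of `o₂` and `p`.
  differences-< : ∀ {o₁ o₂ p} b → o₂ b ≢ p b → o₁ b ≡ p b →
    (∀ x → o₁ x ≡ o₂ x ⊎ o₁ x ≡ p x) →
    length (differences o₁ p) < length (differences o₂ p)
  differences-< {o₁} {o₂} {p} b ne e hybrid = unique-⊆⇒length≤
    (¬Any⇒All¬ _ (λ b∈ → proj₂ (∈-filter⁻ (differ? o₁ p) {xs = allFin N} b∈) e)
      ∷ Unique.filter⁺ (differ? o₁ p) (Unique.allFin⁺ N))
    λ where
      (here refl) → ∈-filter⁺ (differ? o₂ p) (∈-allFin b) ne
      (there x∈) → ∈-filter⁺ (differ? o₂ p) (∈-allFin _)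
        (differs (proj₂ (∈-filter⁻ (differ? o₁ p) {xs = allFin N} x∈)))
    where
    differs : ∀ {x} → o₁ x ≢ p x → o₂ x ≢ p x
    differs {x} ne₁ e₂ with hybrid x
    ... | inj₁ e₁₂ = ne₁ (trans e₁₂ e₂)
    ... | inj₂ e₁  = ne₁ e₁

  Hybrid : Out → Out → Out → Set
  Hybrid f h o = ∀ x → o x ≡ f x ⊎ o x ≡ h x

  -- The second alternative isolates the last vertex b of the h-path at which
  -- f and h disagree.
  last-difference : ∀ {f h} → Reach h x r →
    (∀ {o} → Hybrid f h o → Reach o x r) ⊎
    (∃ λ b → f b ≢ h b × (∀ {o} → Hybrid f h o → o b ≡ h b → Reach o b r))
  last-difference {x} {f = f} {h} (stop e) with f x ≟ᴹ h x
  ... | no ne = inj₂ (x , ne , λ _ e′ → stop (trans e′ e))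
  ... | yes eq = inj₁ λ hyb → stop (trans (either (flip trans eq) id (hyb x)) e)
  last-difference {x} {f = f} {h} (go e q) with last-difference {f = f} q
  ... | inj₂ found = inj₂ found
  ... | inj₁ same with f x ≟ᴹ h x
  ... | no ne = inj₂ (x , ne , λ hyb e′ → go (trans e′ e) (same hyb))
  ... | yes eq = inj₁ λ hyb → go (trans (either (flip trans eq) id (hyb x)) e) (same hyb)

  -- Sums over the vertices.

  module _ {A : Set} (_∙_ : A → A → A) (ε : A)
           (assoc : ∀ a b c → (a ∙ b) ∙ c ≡ a ∙ (b ∙ c)) (comm : ∀ a b → a ∙ b ≡ b ∙ a)
           (h : Fin N → Maybe (Fin N) → A) where

    total : Out → List (Fin N) → A
    total o = foldr (λ i s → h i (o i) ∙ s) ε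

    interchange : ∀ a b c d → (a ∙ b) ∙ (c ∙ d) ≡ (a ∙ c) ∙ (b ∙ d)
    interchange a b c d = begin
      (a ∙ b) ∙ (c ∙ d) ≡⟨ assoc a b (c ∙ d) ⟩
      a ∙ (b ∙ (c ∙ d)) ≡⟨ cong (a ∙_) (assoc b c d) ⟨
      a ∙ ((b ∙ c) ∙ d) ≡⟨ cong (λ z → a ∙ (z ∙ d)) (comm b c) ⟩
      a ∙ ((c ∙ b) ∙ d) ≡⟨ cong (a ∙_) (assoc c b d) ⟩
      a ∙ (c ∙ (b ∙ d)) ≡⟨ assoc a c (b ∙ d) ⟨
      (a ∙ c) ∙ (b ∙ d) ∎
      where open ≡-Reasoning

    -- At each vertex the unordered pair of arcs stays the same. The operation is arbitrary because
    -- tree counts and weights both need this.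
    total-swap : ∀ {o p o′ p′} →
      (∀ x → (o′ x ≡ o x × p′ x ≡ p x) ⊎ (o′ x ≡ p x × p′ x ≡ o x)) →
      ∀ xs → total o′ xs ∙ total p′ xs ≡ total o xs ∙ total p xs
    total-swap swapped [] = refl
    total-swap {o} {p} {o′} {p′} swapped (x ∷ xs) = begin
      (h x (o′ x) ∙ total o′ xs) ∙ (h x (p′ x) ∙ total p′ xs)
        ≡⟨ interchange _ _ _ _ ⟩
      (h x (o′ x) ∙ h x (p′ x)) ∙ (total o′ xs ∙ total p′ xs)
        ≡⟨ cong₂ _∙_ (at (swapped x)) (total-swap swapped xs) ⟩
      (h x (o x) ∙ h x (p x)) ∙ (total o xs ∙ total p xs)
        ≡⟨ interchange _ _ _ _ ⟩
      (h x (o x) ∙ total o xs) ∙ (h x (p x) ∙ total p xs) ∎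
      where
      open ≡-Reasoning
      at : (o′ x ≡ o x × p′ x ≡ p x) ⊎ (o′ x ≡ p x × p′ x ≡ o x) →
           h x (o′ x) ∙ h x (p′ x) ≡ h x (o x) ∙ h x (p x)
      at (inj₁ (e , e′)) = cong₂ (λ m n → h x m ∙ h x n) e e′
      at (inj₂ (e , e′)) = trans (cong₂ (λ m n → h x m ∙ h x n) e e′) (comm _ _)

-- Inequalities and minima in an ordered abelian group.

module _ (G : OrdAbGroup) where
  open OrdAbGroup G renaming (_+_ to _⊕_; _≤_ to _≼_; _<_ to _≺_)
  private module ≼ = IsDecTotalOrder ≤-isDecTotalOrder

  +-inverseʳ : ∀ a → a ⊕ (- a) ≡ 0#
  +-inverseʳ a = trans (+-comm a (- a)) (-‿inverseˡ a)

  +-cancel-middle : ∀ a b c → (a ⊕ c) ⊕ ((- c) ⊕ (- b)) ≡ a - b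
  +-cancel-middle a b c = begin
    (a ⊕ c) ⊕ ((- c) ⊕ (- b)) ≡⟨ +-assoc a c _ ⟩
    a ⊕ (c ⊕ ((- c) ⊕ (- b))) ≡⟨ cong (a ⊕_) (+-assoc c (- c) (- b)) ⟨
    a ⊕ ((c - c) ⊕ (- b))     ≡⟨ cong (λ z → a ⊕ (z ⊕ (- b))) (+-inverseʳ c) ⟩
    a ⊕ (0# ⊕ (- b))          ≡⟨ cong (a ⊕_) (+-identityˡ (- b)) ⟩
    a - b                     ∎
    where open ≡-Reasoning

  +-mono-≼ : ∀ {a b c d} → a ≼ b → c ≼ d → (a ⊕ c) ≼ (b ⊕ d)
  +-mono-≼ {a} {b} {c} {d} a≼b c≼d = ≼.trans (+-monoˡ-≤ c a≼b)
    (subst₂ _≼_ (+-comm c b) (+-comm d b) (+-monoˡ-≤ b c≼d))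

  +-cancelʳ-≼ : ∀ {a b} c → (a ⊕ c) ≼ (b ⊕ c) → a ≼ b
  +-cancelʳ-≼ {a} {b} c le = subst₂ _≼_ (undo a) (undo b) (+-monoˡ-≤ (- c) le)
    where
    undo : ∀ a → (a ⊕ c) ⊕ (- c) ≡ a
    undo a = trans (+-assoc a c (- c)) (trans (cong (a ⊕_) (+-inverseʳ c))
               (trans (+-comm a 0#) (+-identityˡ a)))

  -- Subtracting `b ⊕ c` from the sum inequality gives the reverse of the gap.
  gap⇒sum : ∀ {a b c} → (b - c) ≺ (a - b) → ¬ ((a ⊕ c) ≼ (b ⊕ b))
  gap⇒sum {a} {b} {c} (le , ne) sum = ne (≼.antisym le
    (subst₂ _≼_ (+-cancel-middle a b c)
      (trans (cong ((b ⊕ b) ⊕_) (+-comm (- c) (- b))) (+-cancel-middle b c b))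
      (+-monoˡ-≤ ((- c) ⊕ (- b)) sum)))

  -- `P` need not be decidable, as the arcs of the digraph come without a decision procedure. Hence
  -- the double negation, which suffices for refutations.
  ¬¬-minimum : (P : Carrier → Set) → ∀ ws {x} → P x →
    ¬ ¬ ∃ λ m → P m × m ≼ x × ∀ {y} → P y → y List.∈ ws → m ≼ y
  ¬¬-minimum P []       {x} px k = k (x , px , ≼.refl , λ _ ())
  ¬¬-minimum P (w ∷ ws) {x} px k = ¬¬-minimum P ws px 
    λ { (m , pm , m≼x , below) → case-total m pm m≼x below (≼.total m w) }
    where
    case-total : ∀ m → P m → m ≼ x → (∀ {y} → P y → y List.∈ ws → m ≼ y) →
                 (m ≼ w) ⊎ (w ≼ m) → ⊥
    case-total m pm m≼x below (inj₁ m≼w) = k (m , pm , m≼x , λ where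
      py (here refl) → m≼w
      py (there y∈)  → below py y∈)
    case-total m pm m≼x below (inj₂ w≼m) = k (m , pm , m≼x , λ where
      -- If `P w` held, `w` would be the minimum; so `k` refutes `P w`, and `m` stays minimal.
      pw (here refl) → ⊥-elim (k (w , pw , ≼.trans w≼m m≼x , λ where
        _  (here refl) → ≼.refl
        py (there y∈)  → ≼.trans w≼m (below py y∈)))
      py (there y∈)  → below py y∈)

-- Paths and roots of spanning forests.

module Forests (G : OrdAbGroup) {N : ℕ} (D : Digraph G N) where
  open OrdAbGroup G hiding (_<_)
    renaming (_+_ to _⊕_; _≤_ to _≼_; +-assoc to ⊕-assoc; +-comm to ⊕-comm)
  open Digraph D
  open Graph G D
  private module ≼ = IsDecTotalOrder ≤-isDecTotalOrder

  private variable
    x y r : Fin N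
    F H P Q : SpanningForest

  next : SpanningForest → Out
  next F = out (graph F)

  snocʷ : ∀ {K} → Walk K x y → out K y ≡ just r → Walk K x r
  snocʷ (step e) e′ = e ∷ step e′
  snocʷ (e ∷ w)  e′ = e ∷ snocʷ w e′

  -- A cycle can be rotated along the path to the root, and no arc leaves the root.
  no-cycle : ∀ {K} → Reach (out K) x r → ¬ Walk K x x
  no-cycle (stop e) (step e′) = just≢nothing e′ e
  no-cycle (stop e) (e′ ∷ _)  = just≢nothing e′ e
  no-cycle {K = K} (go e q) (step e′) with just-functional e e′
  ... | refl = no-cycle {K = K} q (step e)
  no-cycle (go e q) (e′ ∷ w) with just-functional e e′
  ... | refl = no-cycle q (snocʷ w e)

  trace⇒walk : ∀ {K n} ((g , _) : Trace (out K) x n) → ∀ {a b} → a < b → b ≤ n →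
               Walk K (g a) (g b)
  trace⇒walk t@(_ , _ , arcs) {b = suc b} (s≤s a≤b) b<n with ℕ.m≤n⇒m<n∨m≡n a≤b
  ... | inj₁ a<b  = snocʷ (trace⇒walk t a<b (ℕ.<⇒≤ b<n)) (arcs b<n)
  ... | inj₂ refl = step (arcs b<n)

  -- A trace of `N` arcs visits `N + 1` vertices, so two of them coincide and close a cycle.
  reaches-root : ∀ F x → ∃ (Reach (next F) x)
  reaches-root F x with reach-or-trace (next F) N x
  ... | inj₁ q = q
  ... | inj₂ t@(g , _) with Fin.pigeonhole (ℕ.n<1+n N) (g ∘ toℕ)
  ... | a , b , a<b , ga≡gb = ⊥-elim (acyclic F (g (toℕ a))
    (subst (Walk (graph F) _) (sym ga≡gb) (trace⇒walk t a<b (Fin.toℕ≤pred[n] b))))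

  -- The root names the tree, which makes lying in the same tree a decidable equality.
  ρ : SpanningForest → Fin N → Fin N
  ρ F x = proj₁ (reaches-root F x)

  reach-ρ : ∀ F x → Reach (next F) x (ρ F x)
  reach-ρ F x = proj₂ (reaches-root F x)

  ρ-isRoot : ∀ F x → IsRoot F (ρ F x)
  ρ-isRoot F x = Reach-end (reach-ρ F x)

  ρ-unique : Reach (next F) x r → ρ F x ≡ r
  ρ-unique {F} {x} = Reach-functional (reach-ρ F x)

  ρ-root : IsRoot F r → ρ F r ≡ r
  ρ-root {F} e = ρ-unique {F} (stop e)

  ρ-next : ∀ F → next F x ≡ just y → ρ F x ≡ ρ F y
  ρ-next F e = ρ-unique {F} (go e (reach-ρ F _))

  -- Mixing two forests along a vertex set.

  record Mix (S : Fin N → Set) (P Q R : SpanningForest) : Set where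
    field
      on  : ∀ {x} → S x → next R x ≡ next P x
      off : ∀ {x} → ¬ S x → next R x ≡ next Q x
  open Mix

  module _ {S : Fin N → Set} (S? : ∀ x → Dec (S x)) where

    mix-hybrid : ∀ {P Q R} → Mix S P Q R → Hybrid (next P) (next Q) (next R)
    mix-hybrid mixR x with S? x
    ... | yes s = inj₁ (on mixR s)
    ... | no ¬s = inj₂ (off mixR ¬s)

    mix : Out → Out → Out
    mix p q x = if does (S? x) then p x else q x

    mix-on : ∀ p q → S x → mix p q x ≡ p x
    mix-on {x} p q s with S? x
    ... | yes _ = refl
    ... | no ¬s = contradiction s ¬s

    mix-off : ∀ p q → ¬ S x → mix p q x ≡ q x
    mix-off {x} p q ¬s with S? x
    ... | yes s = contradiction s ¬s
    ... | no _  = refl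

    mixForest : ∀ P Q → (∀ x → ∃ (Reach (mix (next P) (next Q)) x)) →
                Σ SpanningForest (Mix S P Q)
    mixForest P Q reach = record
      { graph   = record { out = mix (next P) (next Q) ; out⊆V = arcs }
      ; acyclic = λ x → no-cycle (proj₂ (reach x))
      } , record { on = mix-on (next P) (next Q) ; off = mix-off (next P) (next Q) }
      where
      arcs : ∀ x y → mix (next P) (next Q) x ≡ just y → Arc x y
      arcs x y e with S? x
      ... | yes _ = out⊆V (graph P) x y e
      ... | no _  = out⊆V (graph Q) x y e

    -- The `p`-path is followed until it first leaves `S`; there `exit` takes over.
    reach-exit : ∀ p q → (∀ {x} → ¬ S x → ∃ (Reach (mix p q) x)) →
                 Reach p x r → ∃ (Reach (mix p q) x)
    reach-exit {x} p q exit reach with S? x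
    ... | no ¬s = exit ¬s
    reach-exit p q exit (stop e) | yes s = _ , stop (trans (mix-on p q s) e)
    reach-exit p q exit (go e reach) | yes s with reach-exit p q exit reach
    ... | _ , reach′ = _ , go (trans (mix-on p q s) e) reach′

    -- A path of the mixture that is outside `S` runs in `F` and, by `closed`, never returns.
    graft : ∀ F H → (∀ {x y} → ¬ S x → next F x ≡ just y → ¬ S y) →
            Σ SpanningForest (Mix S H F)
    graft F H closed = mixForest H F λ x → reach-exit (next H) (next F) outside (reach-ρ H x)
      where
      outside : ¬ S x → ∃ (Reach (mix (next H) (next F)) x)
      outside {x} ¬s = _ , follow (λ x → ¬ S x) closed (mix-off (next H) (next F)) ¬s (reach-ρ F x)

  inTree : SpanningForest → Fin N → Fin N → Set
  inTree F c x = ρ F x ≡ c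

  inTree? : ∀ F c x → Dec (inTree F c x)
  inTree? F c x = ρ F x Fin.≟ c

  ¬inTree-next : ∀ F {c} → ¬ inTree F c x → next F x ≡ just y → ¬ inTree F c y
  ¬inTree-next F ¬t e t = ¬t (trans (ρ-next F e) t)

  graftTree : ∀ F H c → Σ SpanningForest (Mix (inTree F c) H F)
  graftTree F H c = graft (inTree? F c) F H (¬inTree-next F)

  -- The tree is closed under the arcs of `F`, so `graft` applies to its complement.
  graftTree′ : ∀ F H c → Σ SpanningForest (Mix (inTree F c) F H)
  graftTree′ F H c
    with Q , mixQ ← graft (¬? ∘ inTree? F c) F H
           (λ t e ¬t′ → t λ t → ¬t′ (trans (sym (ρ-next F e)) t))
    = Q , record { on = λ t → off mixQ (λ ¬t → ¬t t) ; off = on mixQ }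

  -- Tree counts and weights as sums over the vertices.

  nRoots : SpanningForest → ℕ
  nRoots F = length (roots (next F))

  indicator : Maybe (Fin N) → ℕ
  indicator nothing  = 1
  indicator (just _) = 0

  arcWeight : Fin N → Maybe (Fin N) → Carrier
  arcWeight i nothing  = 0#
  arcWeight i (just j) = v i j

  count : Out → List (Fin N) → ℕ
  count = total _+_ 0 ℕ.+-assoc ℕ.+-comm (λ _ → indicator)

  sumWeight : Out → List (Fin N) → Carrier
  sumWeight = total _⊕_ 0# ⊕-assoc ⊕-comm arcWeight

  -- numTrees and weight are folds of functions local to their definitions;
  -- unification makes those functions available.
  numTrees-fold : ∀ F → ∃ λ f → foldr f 0 (allFin N) ≡ numTrees F
  numTrees-fold F = _ , refl

  weight-fold : ∀ F → ∃ λ f → foldr f 0# (allFin N) ≡ weight F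
  weight-fold F = _ , refl

  numTrees≡count : ∀ F → numTrees F ≡ count (next F) (allFin N)
  numTrees≡count F = go′ (allFin N)
    where
    go′ : ∀ xs → foldr (proj₁ (numTrees-fold F)) 0 xs ≡ count (next F) xs
    go′ [] = refl
    go′ (x ∷ xs) with next F x
    ... | nothing = cong suc (go′ xs)
    ... | just _  = go′ xs

  weight≡sumWeight : ∀ F → weight F ≡ sumWeight (next F) (allFin N)
  weight≡sumWeight F = go′ (allFin N)
    where
    go′ : ∀ xs → foldr (proj₁ (weight-fold F)) 0# xs ≡ sumWeight (next F) xs
    go′ [] = refl
    go′ (x ∷ xs) with next F x
    ... | nothing = cong (0# ⊕_) (go′ xs)
    ... | just y  = cong (v x y ⊕_) (go′ xs)

  numTrees≡nRoots : ∀ F → numTrees F ≡ nRoots F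
  numTrees≡nRoots F = trans (numTrees≡count F) (go′ (allFin N))
    where
    go′ : ∀ xs → count (next F) xs ≡ length (filter (root? (next F)) xs)
    go′ [] = refl
    go′ (x ∷ xs) with next F x
    ... | nothing = cong suc (go′ xs)
    ... | just _  = go′ xs

  -- A finite superset of the attained weights: each vertex contributes `0#` or any `v i j`, whether
  -- or not that pair is an arc.
  weights : List (Fin N) → List Carrier
  weights = foldr (λ i → cartesianProductWith _⊕_ (0# ∷ map (v i) (allFin N))) [ 0# ]

  weight∈weights : ∀ F → weight F List.∈ weights (allFin N)
  weight∈weights F = subst (List._∈ weights (allFin N)) (sym (weight≡sumWeight F)) (go′ (allFin N))
    where
    arc∈ : ∀ i m → arcWeight i m List.∈ 0# ∷ map (v i) (allFin N)
    arc∈ i nothing  = here refl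
    arc∈ i (just j) = there (∈-map⁺ (v i) (∈-allFin j))
    go′ : ∀ xs → sumWeight (next F) xs List.∈ weights xs
    go′ [] = here refl
    go′ (x ∷ xs) = ∈-cartesianProductWith⁺ _⊕_ (arc∈ x (next F x)) (go′ xs)

  ¬¬-Phi : ∀ {n} F → InF n F → ¬ ¬ ∃ λ m → Phi n (fin m) × m ≼ weight F
  ¬¬-Phi {n} F inF k =
    ¬¬-minimum G (λ w → Σ SpanningForest λ F → InF n F × weight F ≡ w)
      (weights (allFin N)) (F , inF , refl)
      λ { (m , attained , m≼ , below) →
          k (m , (attained , λ F inF → below (F , inF , refl) (weight∈weights F)) , m≼) }

  -- Exchanging arcs and counting roots.

  module _ {S : Fin N → Set} (S? : ∀ x → Dec (S x))
           (mixP : Mix S H F P) (mixQ : Mix S F H Q) where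

    swapped : ∀ x → (next P x ≡ next F x × next Q x ≡ next H x) ⊎
                    (next P x ≡ next H x × next Q x ≡ next F x)
    swapped x with S? x
    ... | yes s = inj₂ (on mixP s , on mixQ s)
    ... | no ¬s = inj₁ (off mixP ¬s , off mixQ ¬s)

    numTrees-swap : numTrees P + numTrees Q ≡ numTrees F + numTrees H
    numTrees-swap
      rewrite numTrees≡count P | numTrees≡count Q | numTrees≡count F | numTrees≡count H
      = total-swap _+_ 0 ℕ.+-assoc ℕ.+-comm (λ _ → indicator) swapped (allFin N)

    weight-swap : weight P ⊕ weight Q ≡ weight F ⊕ weight H
    weight-swap
      rewrite weight≡sumWeight P | weight≡sumWeight Q | weight≡sumWeight F | weight≡sumWeight H
      = total-swap _⊕_ 0# ⊕-assoc ⊕-comm arcWeight swapped (allFin N)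

  -- `P` has no root in the tree of `c` and agrees with `F` elsewhere, so exactly `c` is lost.
  graft-loses-root : ∀ c → IsRoot F c → (∀ x → IsRoot H x → ρ F x ≢ c) →
    Mix (inTree F c) H F P → suc (numTrees P) ≡ numTrees F
  graft-loses-root {F} {H} {P} c rc none mixP = begin
    suc (numTrees P) ≡⟨ cong suc (numTrees≡nRoots P) ⟩
    suc (nRoots P)   ≡⟨ ℕ.≤-antisym (unique-⊆⇒length≤ (¬Any⇒All¬ _ c∉ ∷ roots-unique (next P)) ⊆₁)
                                    (unique-⊆⇒length≤ (roots-unique (next F)) ⊆₂) ⟩
    nRoots F         ≡⟨ numTrees≡nRoots F ⟨
    numTrees F       ∎
    where
    open ≡-Reasoning
    rootP-off : IsRoot P x → ¬ inTree F c x
    rootP-off rx t = none _ (trans (sym (on mixP t)) rx) t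
    c∉ : ¬ (c List.∈ roots (next P))
    c∉ c∈ = rootP-off (∈-roots⁻ c∈) (ρ-root {F} rc)
    ⊆₁ : x List.∈ c ∷ roots (next P) → x List.∈ roots (next F)
    ⊆₁ (here refl) = ∈-roots⁺ rc
    ⊆₁ (there x∈) with rx ← ∈-roots⁻ x∈ =
      ∈-roots⁺ (trans (sym (off mixP (rootP-off rx))) rx)
    ⊆₂ : x List.∈ roots (next F) → x List.∈ c ∷ roots (next P)
    ⊆₂ {x} x∈ with x Fin.≟ c
    ... | yes refl = here refl
    ... | no x≢c with rx ← ∈-roots⁻ x∈ =
      there (∈-roots⁺ (trans (off mixP (x≢c ∘ trans (sym (ρ-root {F} rx)))) rx))

  roots-image : ∀ {xs} → (∀ c → IsRoot F c → ∃ λ x → x List.∈ xs × ρ F x ≡ c) →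
                numTrees F ≤ length xs
  roots-image {F} {xs} hit = subst₂ _≤_ (sym (numTrees≡nRoots F)) (length-map (ρ F) xs)
    (unique-⊆⇒length≤ (roots-unique (next F)) image)
    where
    image : x List.∈ roots (next F) → x List.∈ map (ρ F) xs
    image x∈ with hit _ (∈-roots⁻ x∈)
    ... | y , y∈ , refl = ∈-map⁺ (ρ F) y∈

  hits? : ∀ F H c → Dec (∃ λ x → IsRoot H x × ρ F x ≡ c)
  hits? F H c = Fin.any? λ x → root? (next H) x ×-dec (ρ F x Fin.≟ c)

  -- Otherwise `ρ F` would map the roots of `H` onto those of `F`.
  treeWithoutRoot : ∀ F H → numTrees H < numTrees F →
    ∃ λ c → IsRoot F c × (∀ x → IsRoot H x → ρ F x ≢ c)
  treeWithoutRoot F H lt with Fin.any? (λ c → root? (next F) c ×-dec ¬? (hits? F H c))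
  ... | yes (c , rc , none) = c , rc , λ x rx e → none (x , rx , e)
  ... | no ¬found = contradiction lt (ℕ.≤⇒≯ (subst (numTrees F ≤_) (sym (numTrees≡nRoots H))
    (roots-image {F} λ c rc → hit (decidable-stable (hits? F H c) λ none → ¬found (c , rc , none)))))
    where
    hit : ∀ {c} → (∃ λ x → IsRoot H x × ρ F x ≡ c) →
          ∃ λ x → x List.∈ roots (next H) × ρ F x ≡ c
    hit (x , rx , e) = x , ∈-roots⁺ rx , e

  -- Strict convexity at `k` and exchange of optimal forests.

  module Optimality (k : ℕ)
    (gap : ∀ a b c → Phi (k ∸ 1) a → Phi k b → Phi (suc k) c → (b ⊖ c) <± (a ⊖ b)) where

    record Opt (F : SpanningForest) : Set where
      constructor opt
      field
        inF   : InF k F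
        least : ∀ H → InF k H → weight F ≼ weight H
    open Opt

    no-cheap-neighbours : ∀ {F₀ F H} → Opt F₀ → numTrees F ≡ suc k → suc (numTrees H) ≡ k →
      ¬ (weight F ⊕ weight H ≼ weight F₀ ⊕ weight F₀)
    no-cheap-neighbours {F₀} {F} {H} (opt k₀ min₀) nF nH cheap =
      ¬¬-Phi F nF λ { (c , φc , c≼) →
      -- `nH` makes `k` positive, so `k ∸ 1` is its true predecessor.
      ¬¬-Phi H (cong (_∸ 1) nH) λ { (a , φa , a≼) →
      contra c≼ a≼ (gap (fin a) (fin (weight F₀)) (fin c) φa ((F₀ , k₀ , refl) , min₀) φc) } }
      where
      contra : ∀ {a c} → c ≼ weight F → a ≼ weight H →
               ¬ (fin± (weight F₀ - c) <± fin± (a - weight F₀))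
      contra c≼ a≼ (fin<fin lt) = gap⇒sum G lt
        (≼.trans (+-mono-≼ G a≼ c≼) (subst (_≼ weight F₀ ⊕ weight F₀) (⊕-comm _ _) cheap))

    fewer-trees : ∀ {m f h} → f ≡ suc m + k → suc m + h ≡ k → h < f
    fewer-trees {m} {f} {h} f≡ h≡ = begin-strict
      h         <⟨ ℕ.m≤n+m (suc h) m ⟩
      m + suc h ≡⟨ ℕ.+-suc m h ⟩
      suc m + h ≡⟨ h≡ ⟩
      k         ≤⟨ ℕ.m≤n+m k (suc m) ⟩
      suc m + k ≡⟨ f≡ ⟨
      f         ∎
      where open ℕ.≤-Reasoning

    -- Exchanging on a tree of `F` without roots of `H` moves one root from `F` to `H` at the same
    -- total weight, bringing both tree counts one step closer to `k`.
    no-cheap-pair-above : ∀ m {F₀ F H} → Opt F₀ →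
      numTrees F ≡ suc m + k → suc m + numTrees H ≡ k →
      ¬ (weight F ⊕ weight H ≼ weight F₀ ⊕ weight F₀)
    no-cheap-pair-above zero    {F₀} {F} {H} opt₀ nF nH = no-cheap-neighbours {F = F} {H = H} opt₀ nF nH
    no-cheap-pair-above (suc m) {F₀} {F} {H} opt₀ nF nH cheap
      with c , rc , none ← treeWithoutRoot F H (fewer-trees nF nH)
      with P , mixP ← graftTree F H c | Q , mixQ ← graftTree′ F H c =
      no-cheap-pair-above m {F₀} {P} {Q} opt₀ nP
        (trans (cong (suc m +_) nQ) (trans (ℕ.+-suc (suc m) _) nH))
        (subst (_≼ weight F₀ ⊕ weight F₀) (sym (weight-swap (inTree? F c) mixP mixQ)) cheap)
      where
      nP : numTrees P ≡ suc m + k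
      nP = ℕ.suc-injective (trans (graft-loses-root {F} {H} c rc none mixP) nF)
      nQ : numTrees Q ≡ suc (numTrees H)
      nQ = ℕ.+-cancelˡ-≡ (numTrees P) _ _ (begin
        numTrees P + numTrees Q       ≡⟨ numTrees-swap (inTree? F c) mixP mixQ ⟩
        numTrees F + numTrees H       ≡⟨ cong (_+ numTrees H) (graft-loses-root {F} {H} c rc none mixP) ⟨
        suc (numTrees P) + numTrees H ≡⟨ ℕ.+-suc (numTrees P) _ ⟨
        numTrees P + suc (numTrees H) ∎)
        where open ≡-Reasoning

    no-cheap-pair : ∀ {F₀} F H → Opt F₀ → numTrees F + numTrees H ≡ k + k → numTrees F ≢ k →
      ¬ (weight F ⊕ weight H ≼ weight F₀ ⊕ weight F₀)
    no-cheap-pair {F₀} F H opt₀ sum nF≢k cheap with ℕ.<-cmp (numTrees F) k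
    ... | tri≈ _ nF≡k _ = nF≢k nF≡k
    ... | tri> _ _ k<nF with m , k+m≡nF ← ℕ.m≤n⇒∃[o]m+o≡n k<nF =
      no-cheap-pair-above m {F = F} {H} opt₀ nF
        (ℕ.+-cancelˡ-≡ k _ _ (trans (sym (ℕ.+-assoc k (suc m) _))
          (trans (cong (_+ _) (trans (ℕ.+-comm k (suc m)) (sym nF))) sum))) cheap
      where
      nF : numTrees F ≡ suc m + k
      nF = trans (sym k+m≡nF) (cong suc (ℕ.+-comm k m))
    no-cheap-pair {F₀} F H opt₀ sum nF≢k cheap | tri< nF<k _ _
      with m , nF+m≡k ← ℕ.m≤n⇒∃[o]m+o≡n nF<k =
      no-cheap-pair-above m {F = H} {F} opt₀
        (ℕ.+-cancelˡ-≡ (numTrees F) _ _ (trans sum (trans (cong (_+ k) (sym nF))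
          (trans (cong (_+ k) (ℕ.+-comm (suc m) _)) (ℕ.+-assoc _ (suc m) k)))))
        nF (subst (_≼ weight F₀ ⊕ weight F₀) (⊕-comm _ _) cheap)
      where
      nF : suc m + numTrees F ≡ k
      nF = trans (cong suc (ℕ.+-comm m _)) nF+m≡k

    Optimal-weight : Opt F → Opt H → weight F ≡ weight H
    Optimal-weight {F} {H} (opt kF minF) (opt kH minH) = ≼.antisym (minF H kH) (minH F kF)

    -- The total weight is twice the optimum, so `no-cheap-pair` forces both tree counts to be `k`.
    -- Then neither weight exceeds the optimum, as the other is not below it.
    exchange : {S : Fin N → Set} (S? : ∀ x → Dec (S x)) → Opt F → Opt H →
               Mix S H F P → Mix S F H Q → Opt P × Opt Q
    exchange {F} {H} {P} {Q} S? optF@(opt kF minF) optH@(opt kH _) mixP mixQ =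
      opt kP (λ R kR → ≼.trans (light P Q kQ weights-eq) (minF R kR)) ,
      opt kQ (λ R kR → ≼.trans (light Q P kP (trans (⊕-comm _ _) weights-eq)) (minF R kR))
      where
      trees-eq : numTrees P + numTrees Q ≡ k + k
      trees-eq = trans (numTrees-swap S? mixP mixQ) (cong₂ _+_ kF kH)
      weights-eq : weight P ⊕ weight Q ≡ weight F ⊕ weight F
      weights-eq = trans (weight-swap S? mixP mixQ)
                         (cong (weight F ⊕_) (sym (Optimal-weight optF optH)))
      kP : numTrees P ≡ k
      kP = decidable-stable (numTrees P ℕ.≟ k) λ nP →
        no-cheap-pair P Q optF trees-eq nP (≼.reflexive weights-eq)
      kQ : numTrees Q ≡ k
      kQ = ℕ.+-cancelˡ-≡ k _ _ (trans (cong (_+ _) (sym kP)) trees-eq)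
      light : ∀ P Q → numTrees Q ≡ k → weight P ⊕ weight Q ≡ weight F ⊕ weight F →
              weight P ≼ weight F
      light P Q kQ eq = +-cancelʳ-≼ G (weight F)
        (≼.trans (+-mono-≼ G ≼.refl (minF Q kQ)) (≼.reflexive eq))

    exchangeTree : Opt F → Opt H → ∀ c → Σ SpanningForest λ P → Mix (inTree F c) H F P × Opt P
    exchangeTree {F} {H} optF optH c
      with P , mixP ← graftTree F H c | Q , mixQ ← graftTree′ F H c =
      P , mixP , proj₁ (exchange (inTree? F c) optF optH mixP mixQ)

    -- Grafting `H` on a tree without roots of `H` would give an optimal forest with too few trees.
    tree-has-root : Opt F → Opt H → ∀ x → ∃ λ y → IsRoot H y × ρ F y ≡ ρ F x
    tree-has-root {F} {H} optF optH x = decidable-stable (hits? F H (ρ F x)) contra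
      where
      contra : ¬ ¬ (∃ λ y → IsRoot H y × ρ F y ≡ ρ F x)
      contra none with P , mixP , optP ← exchangeTree optF optH (ρ F x) =
        ℕ.1+n≢n (trans (cong suc (sym (inF optP)))
          (trans (graft-loses-root {F} {H} (ρ F x) (ρ-isRoot F x)
                   (λ y ry e → none (y , ry , e)) mixP)
                 (inF optF)))

    -- Were `x` and `y` distinct, the fewer than `k` roots of `H` other than `x` would still meet
    -- all `k` trees of `F`.
    tree-has-unique-root : Opt F → Opt H → IsRoot H x → IsRoot H y → ρ F x ≡ ρ F y → x ≡ y
    tree-has-unique-root {F} {H} {x} {y} optF optH rx ry ρx≡ρy =
      decidable-stable (x Fin.≟ y) λ x≢y →
      ℕ.<⇒≱ (filter-notAll (¬? ∘ (x Fin.≟_)) (roots (next H))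
               (Any-map contradiction (∈-roots⁺ rx)))
        (subst (_≤ length others) (trans (inF optF) (trans (sym (inF optH)) (numTrees≡nRoots H)))
          (roots-image {F} (hit x≢y)))
      where
      others : List (Fin N)
      others = filter (¬? ∘ (x Fin.≟_)) (roots (next H))
      hit : x ≢ y → ∀ c → IsRoot F c → ∃ λ z → z List.∈ others × ρ F z ≡ c
      hit x≢y c rc with tree-has-root optF optH c
      ... | z , rz , ρz≡ with x Fin.≟ z
      ... | no x≢z   = z , ∈-filter⁺ (¬? ∘ (x Fin.≟_)) (∈-roots⁺ rz) x≢z , trans ρz≡ (ρ-root {F} rc)
      ... | yes refl = y , ∈-filter⁺ (¬? ∘ (x Fin.≟_)) (∈-roots⁺ ry) x≢y ,
                       trans (sym ρx≡ρy) (trans ρz≡ (ρ-root {F} rc))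

    -- Vertices that no optimal forest separates.

    _~_ : Fin N → Fin N → Set
    x ~ y = ∀ F → Opt F → ρ F x ≡ ρ F y

    ~-sym : x ~ y → y ~ x
    ~-sym x~y F optF = sym (x~y F optF)

    -- Grafting the tree of F around q from K moves exactly one root of F, namely
    -- ρ F q, to q; a tree of H meets the roots of both forests exactly once.
    ρ-labeled : ∀ {K q} → Opt K → IsRoot K q → Opt F → ρ F q ~ q
    ρ-labeled {F} {K} {q} optK rq optF H optH
      with P , mixP , optP ← exchangeTree optF optK (ρ F q)
      with y , ry , ρy≡ ← tree-has-root optH optP (ρ F q)
      with ρ F y Fin.≟ ρ F q
    ... | yes t = trans (sym ρy≡) (cong (ρ H)
      (tree-has-unique-root optF optK (trans (sym (on mixP t)) ry) rq t))
    ... | no ¬t with ry′ ← trans (sym (off mixP ¬t)) ry =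
      contradiction (trans (ρ-root {F} ry′)
        (tree-has-unique-root optH optF ry′ (ρ-isRoot F q) ρy≡)) ¬t

    -- If `H` separates `x` from `y`, let `P` be `F` on the `H`-tree of `x` and `H` elsewhere. In
    -- `P` the vertex `x` ends at the `H`-root of `y`, yet by `ρ-labeled` its root lies in the
    -- `H`-tree of `q`, which is that of `x`.
    labeled-closed : ∀ {K q} → Opt K → IsRoot K q → Opt F →
                     x ~ q → next F x ≡ just y → y ~ q
    labeled-closed {F} {x} {y} {K} {q} optK rq optF x~q e H optH =
      trans (decidable-stable (ρ H y Fin.≟ ρ H x) contra) (x~q H optH)
      where
      contra : ¬ ¬ (ρ H y ≡ ρ H x)
      contra y≢x with P , mixP , optP ← exchangeTree optH optF (ρ H x) = y≢x (begin
        ρ H y         ≡⟨ ρ-root {H} (ρ-isRoot H y) ⟨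
        ρ H (ρ H y)   ≡⟨ cong (ρ H) Py ⟨
        ρ H (ρ P x)   ≡⟨ cong (ρ H) (x~q P optP) ⟩
        ρ H (ρ P q)   ≡⟨ ρ-labeled optK rq optP H optH ⟩
        ρ H q         ≡⟨ x~q H optH ⟨
        ρ H x         ∎)
        where
        open ≡-Reasoning
        Py : ρ P x ≡ ρ H y
        Py = ρ-unique {P} (go (trans (on mixP refl) e)
          (follow (λ z → ¬ inTree H (ρ H x) z) (¬inTree-next H) (off mixP) y≢x (reach-ρ H y)))

    -- Arcs that enter the class of a root.

    module _ {K : SpanningForest} {q i j i′ : Fin N} (optK : Opt K) (rq : IsRoot K q)
             (j~q : j ~ q) (i~i′ : i ~ i′) where

      Separates : SpanningForest → Set
      Separates H = Opt H × ρ H i ≢ ρ H j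

      -- By `ρ-labeled` the `F`-root of `j` lies in the `H`-tree of `j`; the `H`-root of `i` does
      -- not.
      ρ-differs : Opt F → Separates H → ρ F i ≡ ρ F j → ρ F i ≢ ρ H i
      ρ-differs {F} {H} optF (optH , sep) Fi≡Fj Fi≡Hi = sep (begin
        ρ H i       ≡⟨ ρ-root {H} (ρ-isRoot H i) ⟨
        ρ H (ρ H i) ≡⟨ cong (ρ H) Fi≡Hi ⟨
        ρ H (ρ F i) ≡⟨ cong (ρ H) (trans Fi≡Fj (j~q F optF)) ⟩
        ρ H (ρ F q) ≡⟨ ρ-labeled optK rq optF H optH ⟩
        ρ H q       ≡⟨ j~q H optH ⟨
        ρ H j       ∎)
        where open ≡-Reasoning

      module Cut {F H : SpanningForest} (optF : Opt F) (sepH : Separates H)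
                 (Fi≡j : next F i ≡ just j) (¬leads : ¬ Leads (next F) i i′) where

        private
          optH = proj₁ sepH

        Below : Fin N → Set
        Below = Leads (next F) i

        Below? : ∀ x → Dec (Below x)
        Below? x = leads? i (reach-ρ F x)

        ¬Below-next : ¬ Below x → next F x ≡ just y → ¬ Below y
        ¬Below-next ¬d e d = ¬d (via e d)

        -- Paths of `F` from the class of `q` stay in it, and `i` is outside because `H` separates
        -- it from `j`.
        ~q⇒¬Below : x ~ q → ¬ Below x
        ~q⇒¬Below x~q arrived   = proj₂ sepH (trans (x~q H optH) (sym (j~q H optH)))
        ~q⇒¬Below x~q (via e d) = ~q⇒¬Below (labeled-closed optK rq optF x~q e) d

        reach-from-j : ∀ o → (∀ {x} → ¬ Below x → o x ≡ next H x) → Reach o j (ρ H j)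
        reach-from-j o agree =
          follow (_~ q) (labeled-closed optK rq optH) (agree ∘ ~q⇒¬Below) j~q (reach-ρ H j)

        inner : Σ SpanningForest (Mix Below H F)
        inner = graft Below? F H ¬Below-next

        P₁ = proj₁ inner
        mix₁ = proj₂ inner

        o₂ : Out
        o₂ = mix Below? (next F) (next H)

        -- `graft` does not yield `outer`, since `H` may enter `Below` and `F` leaves it at `i`. But
        -- a path that enters runs to `i`, steps to `j` and then follows `H` outside `Below`.
        reach₂-Below : Below x → Reach o₂ x (ρ H j)
        reach₂-Below arrived = go (trans (mix-on Below? (next F) (next H) arrived) Fi≡j)
          (reach-from-j o₂ (mix-off Below? (next F) (next H)))
        reach₂-Below d@(via e d′) = go (trans (mix-on Below? (next F) (next H) d) e) (reach₂-Below d′)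

        reach₂ : Reach (next H) x r → ∃ (Reach o₂ x)
        reach₂ {x} q with Below? x
        ... | yes d = _ , reach₂-Below d
        reach₂ (stop e) | no ¬d = _ , stop (trans (mix-off Below? (next F) (next H) ¬d) e)
        reach₂ (go e q) | no ¬d with reach₂ q
        ... | _ , q′ = _ , go (trans (mix-off Below? (next F) (next H) ¬d) e) q′

        outer : Σ SpanningForest (Mix Below F H)
        outer = mixForest Below? F H λ x → reach₂ (reach-ρ H x)

        P₂ = proj₁ outer
        mix₂ = proj₂ outer

        opt₁ : Opt P₁
        opt₁ = proj₁ (exchange Below? optF optH mix₁ mix₂)

        opt₂ : Opt P₂
        opt₂ = proj₂ (exchange Below? optF optH mix₁ mix₂)

        hybrid₁ : Hybrid (next F) (next H) (next P₁)
        hybrid₁ x = swap (mix-hybrid Below? mix₁ x)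

        hybrid₂ : Hybrid (next F) (next H) (next P₂)
        hybrid₂ = mix-hybrid Below? mix₂

        -- In `P₁` the arc of `i` comes from `H`; the root is read off at `i′`, which still follows
        -- `F`.
        ρ₁-i : ρ P₁ i ≡ ρ F i
        ρ₁-i = trans (i~i′ P₁ opt₁) (trans
          (ρ-unique {P₁} (follow (λ x → ¬ Below x) ¬Below-next (off mix₁) ¬leads (reach-ρ F i′)))
          (sym (i~i′ F optF)))

        ρ₂-i : ρ P₂ i ≡ ρ H j
        ρ₂-i = ρ-unique {P₂} (go (trans (on mix₂ arrived) Fi≡j) (reach-from-j (next P₂) (off mix₂)))

        -- `F₁` is `F` on the `P`-tree of `i` and `P` elsewhere. Its paths to `i` stay in that tree
        -- and so are paths of `F`.
        improve : ∀ {P b} → Opt P → Hybrid (next F) (next H) (next P) →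
          next F b ≢ next H b → next P b ≡ next H b → ρ P b ≢ ρ P i →
          ∃ λ F₁ → Opt F₁ × next F₁ i ≡ just j × ¬ Leads (next F₁) i i′ ×
            length (differences (next F₁) (next H)) < length (differences (next F) (next H))
        improve {P} {b} optP hyb ne Pb≡Hb ¬tb
          with F₁ , mixF₁ , optF₁ ← exchangeTree optP optF (ρ P i) =
          F₁ , optF₁ , trans (on mixF₁ refl) Fi≡j , (¬leads ∘ proj₂ ∘ leads-F) ,
          differences-< b ne (trans (off mixF₁ ¬tb) Pb≡Hb) hybrid
          where
          S : Fin N → Set
          S = inTree P (ρ P i)
          leads-F : Leads (next F₁) i x → S x × Leads (next F) i x
          leads-F arrived = refl , arrived
          leads-F {x} (via e l) with leads-F l
          ... | t , l′ with inTree? P (ρ P i) x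
          ... | yes tx = tx , via (trans (sym (on mixF₁ tx)) e) l′
          ... | no ¬tx = contradiction t (¬inTree-next P ¬tx (trans (sym (off mixF₁ ¬tx)) e))
          hybrid : Hybrid (next F) (next H) (next F₁)
          hybrid x with inTree? P (ρ P i) x
          ... | yes tx = inj₁ (on mixF₁ tx)
          ... | no ¬tx with hyb x
          ... | inj₁ e = inj₁ (trans (off mixF₁ ¬tx) e)
          ... | inj₂ e = inj₂ (trans (off mixF₁ ¬tx) e)

      -- Induction on the number of vertices where `F` and `H` differ, with `H` fixed.
      all-leads : ∀ n {F H} → length (differences (next F) (next H)) ≤ n →
        Opt F → Separates H → next F i ≡ just j → ¬ ¬ Leads (next F) i i′
      all-leads n {F} {H} bound optF sepH Fi≡j ¬leads = conclude (last-difference (reach-ρ H i))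
        where
        open Cut optF sepH Fi≡j ¬leads
        Fi≡Fj : ρ F i ≡ ρ F j
        Fi≡Fj = ρ-next F Fi≡j
        recurse : ∀ n → length (differences (next F) (next H)) ≤ n → ∀ {P b} → Opt P →
          Hybrid (next F) (next H) (next P) →
          next F b ≢ next H b → next P b ≡ next H b → ¬ (ρ P b ≢ ρ P i)
        recurse n bound optP hyb ne Pb≡Hb ¬tb with improve optP hyb ne Pb≡Hb ¬tb
        recurse zero bound _ _ _ _ _ | _ , _ , _ , _ , closer = ℕ.n≮0 (ℕ.≤-trans closer bound)
        recurse (suc n) bound _ _ _ _ _ | F₁ , optF₁ , F₁i≡j , ¬leads₁ , closer =
          all-leads n (ℕ.≤-pred (ℕ.≤-trans closer bound)) optF₁ sepH F₁i≡j ¬leads₁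
        same-tree : ∀ {P b} → Opt P → Hybrid (next F) (next H) (next P) →
          next F b ≢ next H b → next P b ≡ next H b → ρ P b ≡ ρ P i
        same-tree optP hyb ne Pb≡Hb =
          decidable-stable (_ Fin.≟ _) (recurse n bound optP hyb ne Pb≡Hb)
        conclude : (∀ {o} → Hybrid (next F) (next H) o → Reach o i (ρ H i)) ⊎
          (∃ λ b → next F b ≢ next H b ×
            (∀ {o} → Hybrid (next F) (next H) o → o b ≡ next H b → Reach o b (ρ H i))) → ⊥
        conclude (inj₁ same) =
          ρ-differs optF sepH Fi≡Fj (ρ-unique {F} (same λ _ → inj₁ refl))
        conclude (inj₂ (b , ne , after)) with Below? b
        -- In `P₁`, `b` follows `H` to the `H`-root of `i`, while `i` keeps its `F`-root.
        ... | yes d = ρ-differs optF sepH Fi≡Fj (begin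
          ρ F i  ≡⟨ ρ₁-i ⟨
          ρ P₁ i ≡⟨ same-tree opt₁ hybrid₁ ne (on mix₁ d) ⟨
          ρ P₁ b ≡⟨ ρ-unique {P₁} (after hybrid₁ (on mix₁ d)) ⟩
          ρ H i  ∎)
          where open ≡-Reasoning
        -- In `P₂`, `b` again ends at the `H`-root of `i`, but `i` ends at the `H`-root of `j`.
        ... | no ¬d = proj₂ sepH (begin
          ρ H i  ≡⟨ ρ-unique {P₂} (after hybrid₂ (off mix₂ ¬d)) ⟨
          ρ P₂ b ≡⟨ same-tree opt₂ hybrid₂ ne (off mix₂ ¬d) ⟩
          ρ P₂ i ≡⟨ ρ₂-i ⟩
          ρ H j  ∎)
          where open ≡-Reasoning

      only-exit : ∀ {F j′} → Opt F → next F i ≡ just j → next F i′ ≡ just j′ →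
        ¬ (i ~ j) → ¬ (i′ ~ j′) → i′ ≡ i
      only-exit {F} {j′} optF Fi≡j Fi′≡j′ i≁j i′≁j′ =
        decidable-stable (i′ Fin.≟ i) λ i′≢i →
        -- No separating forest is extracted from the negated equivalences: roots are decidably
        -- equal, so refuting separation by `H` and by `L` is enough.
        i′≁j′ λ H optH → decidable-stable (ρ H i′ Fin.≟ ρ H j′) λ sep′ →
        i≁j λ L optL → decidable-stable (ρ L i Fin.≟ ρ L j) λ sep →
        contra i′≢i H optH sep′ (optL , sep)
        where
        contra : i′ ≢ i → ∀ H → Opt H → ρ H i′ ≢ ρ H j′ → ∀ {L} → ¬ Separates L
        contra i′≢i H optH sep′ sepL
          with P , mixP , optP ← exchangeTree optH optF (ρ H i) =
          all-leads _ ℕ.≤-refl optP sepL (trans (on mixP refl) Fi≡j) ¬leads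
          where
          leads-S : Leads (next P) i x → inTree H (ρ H i) x
          leads-S arrived = refl
          leads-S {x} (via e l) = decidable-stable (inTree? H (ρ H i) x) λ ¬t →
            ¬inTree-next H ¬t (trans (sym (off mixP ¬t)) e) (leads-S l)
          i′∈S : inTree H (ρ H i) i′
          i′∈S = sym (i~i′ H optH)
          ¬leads : ¬ Leads (next P) i i′
          ¬leads arrived = i′≢i refl
          -- Such a path starts with `i′ → j′` and would put `j′` in the `H`-tree of `i`, which
          -- contains `i′`.
          ¬leads (via e l) with just-functional (trans (on mixP i′∈S) Fi′≡j′) e
          ... | refl = sep′ (trans i′∈S (sym (leads-S l)))

    -- From the equivalence to the algebra and its atoms.

    WConn⇒ρ≡ : ∀ F → WConn F x y → ρ F x ≡ ρ F y
    WConn⇒ρ≡ F wrefl      = refl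
    WConn⇒ρ≡ F (wfwd e c) = trans (ρ-next F e) (WConn⇒ρ≡ F c)
    WConn⇒ρ≡ F (wbwd e c) = trans (sym (ρ-next F e)) (WConn⇒ρ≡ F c)

    Reach⇒WConn : Reach (next F) x r → WConn F x r
    Reach⇒WConn (stop _) = wrefl
    Reach⇒WConn (go e q) = wfwd e (Reach⇒WConn q)

    -- Trees of optimal forests are unions of classes, and complements and intersections preserve
    -- this.
    InAlg-resp-~ : ∀ {B} → InAlg k B → x ~ y → x ∈ B → y ∈ B
    InAlg-resp-~ {x} {y} (gen F r (inF , least) rr spec) x~y x∈B =
      proj₂ (spec y) (subst (WConn F y) ρy≡r (Reach⇒WConn (reach-ρ F y)))
      where
      ρy≡r : ρ F y ≡ r
      ρy≡r = trans (sym (x~y F (opt inF least)))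
        (trans (WConn⇒ρ≡ F (proj₁ (spec x) x∈B)) (ρ-root {F} rr))
    InAlg-resp-~ (compl B) x~y x∈ =
      x∉p⇒x∈∁p λ y∈ → x∈∁p⇒x∉p x∈ (InAlg-resp-~ B (~-sym x~y) y∈)
    InAlg-resp-~ (inter {S} {T} B C) x~y x∈ with x∈S , x∈T ← x∈p∩q⁻ S T x∈ =
      x∈p∩q⁺ (InAlg-resp-~ B x~y x∈S , InAlg-resp-~ C x~y x∈T)

    treeOf : SpanningForest → Fin N → Subset N
    treeOf F c = tabulate (λ z → does (inTree? F c z))

    ∈-treeOf⁺ : ∀ F {c} → inTree F c x → x ∈ treeOf F c
    ∈-treeOf⁺ {x} F {c} t = lookup⇒[]= x _ (trans (lookup∘tabulate _ x) (dec-true (inTree? F c x) t))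

    ∈-treeOf⁻ : ∀ F {c} → x ∈ treeOf F c → inTree F c x
    ∈-treeOf⁻ {x} F {c} x∈
      with inTree? F c x
         | trans (sym (lookup∘tabulate (λ z → does (inTree? F c z)) x)) ([]=⇒lookup x∈)
    ... | yes t | _ = t

    treeOf-InAlg : Opt F → ∀ c → InAlg k (treeOf F (ρ F c))
    treeOf-InAlg {F} (opt inF least) c = gen F (ρ F c) (inF , least) (ρ-isRoot F c) λ i →
      (λ i∈ → subst (WConn F i) (∈-treeOf⁻ F i∈) (Reach⇒WConn (reach-ρ F i))) ,
      (λ conn → ∈-treeOf⁺ F (trans (WConn⇒ρ≡ F conn) (ρ-root {F} (ρ-isRoot F c))))

    -- An atom that meets a tree of an optimal forest lies inside it.
    atom-~ : ∀ {U} → IsAtom k U → x ∈ U → y ∈ U → x ~ y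
    atom-~ {x} {y} {U} (_ , _ , atomic) x∈U y∈U F optF
      with atomic (treeOf F (ρ F x)) (treeOf-InAlg optF x)
    ... | inj₁ ∩≡⊥ = contradiction (subst (x ∈_) ∩≡⊥ (x∈p∩q⁺ (x∈U , ∈-treeOf⁺ F refl))) ∉⊥
    ... | inj₂ ∩≡U = sym (∈-treeOf⁻ F (proj₂ (x∈p∩q⁻ U _ (subst (y ∈_) (sym ∩≡U) y∈U))))

theorem2 : (G : OrdAbGroup) (N : ℕ) (D : Digraph G N) →
    let open Graph G D in
    HasSpanningTree →
    (k : ℕ) → 1 ≤ k → k ≤ N →
    (∀ a b c → Phi (k ∸ 1) a → Phi k b → Phi (suc k) c → (b ⊖ c) <± (a ⊖ b)) →
    (F : SpanningForest) → Optimal k F →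
    (U M : Subset N) → IsAtom k U → ¬ Labeled k U → IsAtom k M → Labeled k M →
    (i j : Fin N) → out (graph F) i ≡ just j → i ∈ U → j ∉ U → j ∈ M →
    ∀ i′ j′ → out (graph F) i′ ≡ just j′ → i′ ∈ U → j′ ∉ U →
    (i′ ≡ i) × (j′ ≡ j)
theorem2 G N D _ k _ _ gap F (inF , least) U M atomU _ atomM (K , (inK , leastK) , q , rq , q∈M)
  i j Fi≡j i∈U j∉U j∈M i′ j′ Fi′≡j′ i′∈U j′∉U =
  i′≡i , just-functional (trans (sym (cong (out (graph F)) i′≡i)) Fi′≡j′) Fi≡j
  where
  open Graph G D
  open Forests G D
  open Optimality k gap
  algU = proj₁ (proj₂ atomU)
  i′≡i : i′ ≡ i
  i′≡i = only-exit {K = K} (opt inK leastK) rq (atom-~ atomM j∈M q∈M) (atom-~ atomU i∈U i′∈U)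
    {F = F} (opt inF least) Fi≡j Fi′≡j′
    (λ i~j → j∉U (InAlg-resp-~ algU i~j i∈U))
    (λ i′~j′ → j′∉U (InAlg-resp-~ algU i′~j′ i′∈U))
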